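{- In any oriented graph, a vertex of maximum score is a weak king.
   Context: An oriented graph is a digraph with no loops and no pair of symmetric arcs. For vertices $u,v$ write $u(1\text{ - }0)v$ if there is an arc from $u$ to $v$, and $u(0\text{ - }0)v$ if there is no arc between $u$ and $v$. If $D$ has $n$ vertices, the score of a vertex $v$ is $s(v) = n-1+d^+(v)-d^-(v)$, where $d^+(v), d^-(v)$ are the out- and indegree of $v$. A vertex $v$ is weakly reachable within two steps from $u$ if $u(1\text{ - }0)v$, or $u(0\text{ - }0)v$, or for some vertex $w$ one has $u(1\text{ - }0)w(1\text{ - }0)v$, or $u(1\text{ - }0)w(0\text{ - }0)v$, or $u(0\text{ - }0)w(1\text{ - }0)v$. A vertex $u$ of $D$ is a weak king if every other vertex of $D$ is weakly reachable within two steps from $u$. -}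

module Defs where

open import Data.Fin.Base using (Fin)
open import Data.Integer.Base using (ℤ; +_; _+_; _-_; _≤_)
open import Data.List.Base using (length; filter; allFin)
open import Data.Nat.Base using (ℕ)
open import Data.Product.Base using (_×_; ∃-syntax)
open import Data.Sum.Base using (_⊎_)
open import Level using (0ℓ)
open import Relation.Binary.Core using (Rel)
open import Relation.Binary.Definitions using (Decidable)
open import Relation.Binary.PropositionalEquality.Core using (_≢_)
open import Relation.Nullary.Negation.Core using (¬_)

-- Decidability of arcs is part of what a finite digraph is: it is what makes
-- the degrees well-defined natural numbers constructively.
record OrientedGraph (n : ℕ) : Set₁ where
  field
    Arc         : Rel (Fin n) 0ℓ
    arc?        : Decidable Arc
    noLoop      : ∀ u → ¬ Arc u u
    noSymmetric : ∀ u v → ¬ (Arc u v × Arc v u)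

module _ {n : ℕ} (D : OrientedGraph n) where
  open OrientedGraph D

  -- u (0-0) v
  NoArcBetween : Rel (Fin n) 0ℓ
  NoArcBetween u v = ¬ Arc u v × ¬ Arc v u

  outdegree : Fin n → ℕ
  outdegree v = length (filter (λ w → arc? v w) (allFin n))

  indegree : Fin n → ℕ
  indegree v = length (filter (λ w → arc? w v) (allFin n))

  -- Integer-valued, so that neither subtraction is truncated.
  score : Fin n → ℤ
  score v = + n - + 1 + + outdegree v - + indegree v

  HasMaximumScore : Fin n → Set
  HasMaximumScore u = ∀ v → score v ≤ score u

  -- The intermediate vertex w is not required to differ from u and v: the
  -- extra instances w = u and w = v either need a loop or give Arc u v again.
  WeaklyReachable≤2 : Rel (Fin n) 0ℓ
  WeaklyReachable≤2 u v =
      Arc u v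
    ⊎ NoArcBetween u v
    ⊎ (∃[ w ] ( (Arc u w × Arc w v)
              ⊎ (Arc u w × NoArcBetween w v)
              ⊎ (NoArcBetween u w × Arc w v)))

  WeakKing : Fin n → Set
  WeakKing u = ∀ v → v ≢ u → WeaklyReachable≤2 u v

{-# OPTIONS --safe #-}
-- If v is not weakly reachable from u within two steps, then v → u, every
-- out-neighbour of u is one of v, and every in-neighbour of v is one of u.
-- Moreover u itself is an out-neighbour of v but not of u, so the score of v
-- strictly exceeds that of u.
module Submission where

open import Defs
open import Data.Nat.Base using (ℕ; _≤_; _<_)
open import Data.Fin.Base using (Fin)

open import Data.Fin.Properties using (any?)
open import Data.Integer.Base as ℤ using (+_)
import Data.Integer.Properties as ℤ
open import Data.List.Base using (length; filter; allFin)
open import Data.List.Membership.Propositional using (_∈_)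
open import Data.List.Membership.Propositional.Properties using (∈-allFin; ∈-filter⁺; ∈-filter⁻)
open import Data.List.Relation.Binary.Pointwise using (Pointwise-≡⇒≡)
open import Data.List.Relation.Binary.Sublist.Heterogeneous.Properties using (toPointwise)
open import Data.List.Relation.Binary.Sublist.Propositional using (_⊆_; ⊆-refl)
open import Data.List.Relation.Binary.Sublist.Propositional.Properties using (filter⁺; length-mono-≤)
open import Data.Nat.Properties using (≤∧≢⇒<)
open import Data.Product.Base using (_,_; proj₂)
open import Data.Sum.Base using (inj₁; inj₂)
open import Level using (Level)
open import Relation.Binary.Definitions using (Decidable)
open import Relation.Binary.PropositionalEquality using (refl; sym; subst)
open import Relation.Nullary using (¬_; ¬?; _×-dec_; _⊎-dec_; decidable-stable)
import Relation.Unary as U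

private
  variable
    a p q : Level
    A : Set a
    P : U.Pred A p
    Q : U.Pred A q

module _ (P? : U.Decidable P) (Q? : U.Decidable Q) (P⊆Q : ∀ {x} → P x → Q x) where

  filter-mono-⊆ : ∀ xs → filter P? xs ⊆ filter Q? xs
  filter-mono-⊆ xs = filter⁺ P? Q? (λ { refl → P⊆Q }) (⊆-refl {x = xs})

  length-filter-mono-≤ : ∀ xs → length (filter P? xs) ≤ length (filter Q? xs)
  length-filter-mono-≤ xs = length-mono-≤ (filter-mono-⊆ xs)

  -- A sublist as long as the whole list equals it. So if the lengths agreed, `x`, which survives
  -- the filter by `Q?`, would also survive the one by `P?`.
  length-filter-mono-< : ∀ {x xs} → x ∈ xs → Q x → ¬ P x →
                         length (filter P? xs) < length (filter Q? xs)
  length-filter-mono-< {x} {xs} x∈xs Qx ¬Px =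
    ≤∧≢⇒< (length-filter-mono-≤ xs) λ eq →
      ¬Px (proj₂ (∈-filter⁻ P? {xs = xs}
        (subst (x ∈_) (sym (Pointwise-≡⇒≡ (toPointwise eq (filter-mono-⊆ xs))))
          (∈-filter⁺ Q? x∈xs Qx))))

module _ {n : ℕ} (D : OrientedGraph n) where
  open OrientedGraph D

  noArcBetween? : Decidable (NoArcBetween D)
  noArcBetween? u v = ¬? (arc? u v) ×-dec ¬? (arc? v u)

  -- This licenses arguing by contradiction from unreachability; the intermediate vertex is found by
  -- search over `Fin n`.
  weaklyReachable≤2? : Decidable (WeaklyReachable≤2 D)
  weaklyReachable≤2? u v =
    arc? u v ⊎-dec noArcBetween? u v ⊎-dec any? λ w →
      (arc? u w ×-dec arc? w v)
      ⊎-dec (arc? u w ×-dec noArcBetween? w v)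
      ⊎-dec (noArcBetween? u w ×-dec arc? w v)

  score-mono-< : ∀ {u v} → outdegree D u < outdegree D v → indegree D v ≤ indegree D u →
                 score D u ℤ.< score D v
  score-mono-< out< in≤ =
    -- `score` associates to the left: the last summand is the negated indegree, and the outdegree
    -- is added to the common `+ n - + 1`.
    ℤ.+-mono-<-≤ (ℤ.+-monoʳ-< (+ n ℤ.- + 1) (ℤ.+<+ out<)) (ℤ.neg-mono-≤ (ℤ.+≤+ in≤))

  module _ {u v : Fin n} (¬reach : ¬ WeaklyReachable≤2 D u v) where

    unreachable⇒Arc : Arc v u
    unreachable⇒Arc = decidable-stable (arc? v u) λ ¬vu →
      ¬reach (inj₂ (inj₁ ((λ uv → ¬reach (inj₁ uv)) , ¬vu)))

    -- After the arc from `u` to `w`, both an arc from `w` to `v` and no arc between them would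
    -- reach `v`; only the arc from `v` to `w` is left.
    unreachable⇒out⊆out : ∀ {w} → Arc u w → Arc v w
    unreachable⇒out⊆out {w} uw = decidable-stable (arc? v w) λ ¬vw →
      ¬reach (inj₂ (inj₂ (w , inj₂ (inj₁ (uw ,
        (λ wv → ¬reach (inj₂ (inj₂ (w , inj₁ (uw , wv))))) , ¬vw)))))

    -- Dually, the last step from `w` to `v` is fixed, and the first step from `u` to `w` can be
    -- neither (1-0) nor (0-0).
    unreachable⇒in⊆in : ∀ {w} → Arc w v → Arc w u
    unreachable⇒in⊆in {w} wv = decidable-stable (arc? w u) λ ¬wu →
      ¬reach (inj₂ (inj₂ (w , inj₂ (inj₂
        (((λ uw → ¬reach (inj₂ (inj₂ (w , inj₁ (uw , wv))))) , ¬wu) , wv)))))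

    unreachable⇒score-< : score D u ℤ.< score D v
    unreachable⇒score-< = score-mono-<
      (length-filter-mono-< (arc? u) (arc? v) unreachable⇒out⊆out
        (∈-allFin u) unreachable⇒Arc (noLoop u))
      (length-filter-mono-≤ (λ w → arc? w v) (λ w → arc? w u) unreachable⇒in⊆in (allFin n))

theorem5 : ∀ (n : ℕ) (D : OrientedGraph n) (u : Fin n) → HasMaximumScore D u → WeakKing D u
theorem5 n D u max v _ = decidable-stable (weaklyReachable≤2? D u v) λ ¬reach →
  ℤ.<⇒≱ (unreachable⇒score-< D ¬reach) (max v)
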